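{- The pointed acyclic types are closed under colimits in $\mathcal U_\ast$: for every graph $\Gamma$ and every $\Gamma$-shaped diagram $F$ in the wild category $\mathcal U_\ast$ of pointed types such that the underlying type of $F_i$ is acyclic for every vertex $i:\Gamma_0$, the underlying type of the colimit of $F$ in $\mathcal U_\ast$ is acyclic.
   Context: Everything is inside Book HoTT with pushout types; $p\cdot q$ is path concatenation, $\mathsf{ap}_f$ the action of $f$ on paths. A type is acyclic if its suspension is contractible. $\mathcal U_\ast$ is the wild category of pointed types in the universe $\mathcal U$, with hom types the types of pointed maps, the usual composition and identities, and the evident associativity law $\mathsf{assoc}(f,g,h):(f\circ g)\circ h=f\circ(g\circ h)$. Graph $\Gamma$: a type $\Gamma_0:\mathcal U$ of vertices and a family $\Gamma_1:\Gamma_0\to\Gamma_0\to\mathcal U$ of edges. Diagram $F$: objects $F_i$ and morphisms $F_{i,j,g}:\mathsf{hom}(F_i,F_j)$ for $g:\Gamma_1(i,j)$. Cocone $(C,r,K)$ under $F$: an object $C$, $r_i:\mathsf{hom}(F_i,C)$, paths $K_{i,j,g}:r_j\circ F_{i,j,g}=r_i$. It is colimiting, and $C$ is then a colimit of $F$, if for every object $X$ the map $\mathsf{hom}(C,X)\to\sum_{s:\prod_i\mathsf{hom}(F_i,X)}\prod_{i,j,g}s_j\circ F_{i,j,g}=s_i$, $f\mapsto(\lambda i.f\circ r_i,\ \mathsf{assoc}(f,r_j,F_{i,j,g})\cdot\mathsf{ap}_{f\circ- }(K_{i,j,g}))$ is an equivalence. Colimits in $\mathcal U_\ast$ exist and are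 unique up to pointed equivalence; concretely, the colimit of $F$ can be taken to be the cofiber of the map $\mathsf{colim}_\Gamma(\mathbf 1)\to\mathsf{colim}_\Gamma(\mathsf{ty}\circ F)$ between colimits of types induced by the basepoints, where $\mathsf{ty}$ is the underlying type. -}

{-# OPTIONS --without-K #-}
module Defs where

-- --without-K is essential here: _≡_ plays the role of the identity type of
-- Book HoTT, so types must be allowed to carry higher structure.

open import Level using (Level; Setω; _⊔_) renaming (suc to lsuc)
open import Data.Product using (Σ; Σ-syntax; _×_; _,_; proj₁; proj₂)
open import Data.Unit.Polymorphic using (⊤; tt)
open import Function using (_∘′_)
open import Relation.Binary.PropositionalEquality
  using (_≡_; refl; sym; trans; cong; dcong; subst)
open import Relation.Binary.PropositionalEquality.Properties
  using (trans-reflʳ; cong-id)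

private
  variable
    ℓ o h : Level

isContr : Set ℓ → Set ℓ
isContr A = Σ[ c ∈ A ] (∀ x → c ≡ x)

-- Bi-invertibility, so that being an equivalence is a proposition.
isEquiv : ∀ {a b} {A : Set a} {B : Set b} → (A → B) → Set (a ⊔ b)
isEquiv {A = A} {B} f =
  (Σ[ g ∈ (B → A) ] (∀ y → f (g y) ≡ y)) × (Σ[ k ∈ (B → A) ] (∀ x → k (f x) ≡ x))

-- Agda without cubical features has no higher inductive types, so the
-- formation, introduction, elimination and computation rules of pushouts are
-- collected in a record that results take as a hypothesis.  In Book HoTT
-- elim-inl and elim-inr hold judgmentally; the identifications asked for here
-- are weaker, and elim-glue is accordingly corrected by them.
record PushoutTypes : Setω where
  field
    Pushout : ∀ {ℓ} {A B C : Set ℓ} (f : C → A) (g : C → B) → Set ℓ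

    inl  : ∀ {ℓ} {A B C : Set ℓ} {f : C → A} {g : C → B} → A → Pushout f g
    inr  : ∀ {ℓ} {A B C : Set ℓ} {f : C → A} {g : C → B} → B → Pushout f g
    glue : ∀ {ℓ} {A B C : Set ℓ} {f : C → A} {g : C → B} (c : C) →
           inl {f = f} {g = g} (f c) ≡ inr (g c)

    elim : ∀ {ℓ p} {A B C : Set ℓ} {f : C → A} {g : C → B}
           (P : Pushout f g → Set p)
           (l : ∀ a → P (inl a)) (r : ∀ b → P (inr b))
           (e : ∀ c → subst P (glue c) (l (f c)) ≡ r (g c)) →
           ∀ x → P x

    elim-inl : ∀ {ℓ p} {A B C : Set ℓ} {f : C → A} {g : C → B}
               (P : Pushout f g → Set p)
               (l : ∀ a → P (inl a)) (r : ∀ b → P (inr b))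
               (e : ∀ c → subst P (glue c) (l (f c)) ≡ r (g c)) →
               ∀ a → elim P l r e (inl a) ≡ l a
    elim-inr : ∀ {ℓ p} {A B C : Set ℓ} {f : C → A} {g : C → B}
               (P : Pushout f g → Set p)
               (l : ∀ a → P (inl a)) (r : ∀ b → P (inr b))
               (e : ∀ c → subst P (glue c) (l (f c)) ≡ r (g c)) →
               ∀ b → elim P l r e (inr b) ≡ r b
    elim-glue : ∀ {ℓ p} {A B C : Set ℓ} {f : C → A} {g : C → B}
                (P : Pushout f g → Set p)
                (l : ∀ a → P (inl a)) (r : ∀ b → P (inr b))
                (e : ∀ c → subst P (glue c) (l (f c)) ≡ r (g c)) →
                ∀ c → dcong (elim P l r e) (glue c)
                      ≡ trans (cong (subst P (glue c)) (elim-inl P l r e (f c)))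
                              (trans (e c) (sym (elim-inr P l r e (g c))))

module _ (PO : PushoutTypes) where
  open PushoutTypes PO

  Susp : Set ℓ → Set ℓ
  Susp {ℓ} A = Pushout {A = ⊤ {ℓ}} {B = ⊤ {ℓ}} {C = A} (λ _ → tt) (λ _ → tt)

  Acyclic : Set ℓ → Set ℓ
  Acyclic A = isContr (Susp A)

record WildCategory (o h : Level) : Set (lsuc (o ⊔ h)) where
  infixr 9 _∘_
  field
    Ob    : Set o
    hom   : Ob → Ob → Set h
    id    : ∀ {A} → hom A A
    _∘_   : ∀ {A B C} → hom B C → hom A B → hom A C
    idˡ   : ∀ {A B} (f : hom A B) → id ∘ f ≡ f
    idʳ   : ∀ {A B} (f : hom A B) → f ∘ id ≡ f
    assoc : ∀ {A B C D} (f : hom C D) (g : hom B C) (k : hom A B) →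
            (f ∘ g) ∘ k ≡ f ∘ (g ∘ k)

record Graph (ℓ : Level) : Set (lsuc ℓ) where
  field
    Γ₀ : Set ℓ
    Γ₁ : Γ₀ → Γ₀ → Set ℓ

module _ (𝒞 : WildCategory o h) where
  open WildCategory 𝒞

  record Diagram (Γ : Graph ℓ) : Set (ℓ ⊔ o ⊔ h) where
    open Graph Γ
    field
      obj : Γ₀ → Ob
      mor : ∀ {i j} → Γ₁ i j → hom (obj i) (obj j)

module _ {𝒞 : WildCategory o h} {Γ : Graph ℓ} (F : Diagram 𝒞 Γ) where
  open WildCategory 𝒞
  open Graph Γ
  open Diagram F

  CoconeOn : Ob → Set (ℓ ⊔ h)
  CoconeOn X =
    Σ[ s ∈ (∀ i → hom (obj i) X) ] (∀ i j (g : Γ₁ i j) → s j ∘ mor g ≡ s i)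

  record Cocone : Set (ℓ ⊔ o ⊔ h) where
    field
      apex : Ob
      leg  : ∀ i → hom (obj i) apex
      comm : ∀ i j (g : Γ₁ i j) → leg j ∘ mor g ≡ leg i

  module _ (κ : Cocone) where
    open Cocone κ

    postcomp : (X : Ob) → hom apex X → CoconeOn X
    postcomp X f =
      (λ i → f ∘ leg i) ,
      (λ i j g → trans (assoc f (leg j) (mor g)) (cong (f ∘_) (comm i j g)))

    IsColimiting : Set (ℓ ⊔ o ⊔ h)
    IsColimiting = (X : Ob) → isEquiv (postcomp X)

record Pointed (ℓ : Level) : Set (lsuc ℓ) where
  field
    ty : Set ℓ
    pt : ty

open Pointed public

infix 4 _→∗_
record _→∗_ (A B : Pointed ℓ) : Set ℓ where
  constructor _,∗_
  field
    fun    : ty A → ty B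
    fun-pt : fun (pt A) ≡ pt B

id∗ : {A : Pointed ℓ} → A →∗ A
id∗ = (λ x → x) ,∗ refl

infixr 9 _∘∗_
_∘∗_ : {A B C : Pointed ℓ} → B →∗ C → A →∗ B → A →∗ C
(g ,∗ g₀) ∘∗ (f ,∗ f₀) = (g ∘′ f) ,∗ trans (cong g f₀) g₀

idˡ∗ : {A B : Pointed ℓ} (f : A →∗ B) → id∗ ∘∗ f ≡ f
idˡ∗ (f ,∗ f₀) = cong (f ,∗_) (trans (trans-reflʳ (cong (λ x → x) f₀)) (cong-id f₀))

private
  assoc-pt : {B C D : Set ℓ} (f : C → D) (g : B → C)
             {b b′ : B} {c : C} {d : D}
             (k₀ : b ≡ b′) (g₀ : g b′ ≡ c) (f₀ : f c ≡ d) →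
             trans (cong (f ∘′ g) k₀) (trans (cong f g₀) f₀)
             ≡ trans (cong f (trans (cong g k₀) g₀)) f₀
  assoc-pt f g refl g₀ f₀ = refl

assoc∗ : {A B C D : Pointed ℓ} (f : C →∗ D) (g : B →∗ C) (k : A →∗ B) →
         (f ∘∗ g) ∘∗ k ≡ f ∘∗ (g ∘∗ k)
assoc∗ (f ,∗ f₀) (g ,∗ g₀) (k ,∗ k₀) =
  cong ((f ∘′ g ∘′ k) ,∗_) (assoc-pt f g k₀ g₀ f₀)

𝒰∗ : (ℓ : Level) → WildCategory (lsuc ℓ) ℓ
𝒰∗ ℓ = record
  { Ob    = Pointed ℓ
  ; hom   = _→∗_
  ; id    = id∗
  ; _∘_   = _∘∗_
  ; idˡ   = idˡ∗
  ; idʳ   = λ _ → refl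
  ; assoc = assoc∗
  }

{-# OPTIONS --without-K #-}
module Submission where

-- For pointed A, pointed maps ΣA →∗ Y correspond to pointed maps A →∗ ΩY.
-- Hence A is acyclic exactly when A →∗ ΩY is contractible for every pointed Y:
-- one direction is immediate, and for the other it suffices that the unit
-- A →∗ ΩΣA of the adjunction is constant.  The condition is stable under
-- colimits, since hom(C, ΩY) embeds in the type of cocones under F with
-- apex ΩY, which is a proposition when every hom(F i, ΩY) is.

open import Level using (Level)
open import Axiom.Extensionality.Propositional using (Extensionality)
open import Axiom.UniquenessOfIdentityProofs using (module Constant⇒UIP)
open import Data.Product using (_,_; Σ-syntax; proj₁; proj₂)
open import Data.Unit.Polymorphic using (tt)
open import Function using (_∘′_)
open import Relation.Binary.PropositionalEquality
open import Relation.Binary.PropositionalEquality.Properties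
  using (trans-assoc; trans-reflʳ; trans-symʳ)
open import Relation.Nullary using (Irrelevant)
open import Defs

private
  variable
    a b ℓ : Level

-- Hedberg's argument: `irr x y` induces a constant endomap of each path type `x ≡ y`.
irrelevant⇒≡-irrelevant : {A : Set a} → Irrelevant A →
                          {x y : A} → Irrelevant (x ≡ y)
irrelevant⇒≡-irrelevant irr =
  Constant⇒UIP.≡-irrelevant (λ {x} {y} _ → irr x y) (λ _ _ → refl)

isContr⇒irrelevant : {A : Set a} → isContr A → Irrelevant A
isContr⇒irrelevant (c , contr) x y = trans (sym (contr x)) (contr y)

isEquiv⇒injective : {A : Set a} {B : Set b} {f : A → B} → isEquiv f →
                    ∀ {x y} → f x ≡ f y → x ≡ y
isEquiv⇒injective (_ , k , kf) {x} {y} eq =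
  trans (sym (kf x)) (trans (cong k eq) (kf y))

subst-const : {A : Set a} {B : Set b} {x y : A} (p : x ≡ y) {u : B} →
              subst (λ _ → B) p u ≡ u
subst-const refl = refl

Ω : Pointed ℓ → Pointed ℓ
Ω Y = record { ty = pt Y ≡ pt Y ; pt = refl }

const∗ : {A B : Pointed ℓ} → A →∗ B
const∗ {B = B} = (λ _ → pt B) ,∗ refl

module _ (ext : ∀ {a b} → Extensionality a b) where

  -- Extensionality carries no computation rule, so it is applied to maps into
  -- the singleton type of pt B, which keep track of the null-homotopy.
  nullHomotopic⇒≡const∗ : {A B : Pointed ℓ} (f : ty A → ty B)
                          (H : ∀ x → f x ≡ pt B) →
                          _≡_ {A = A →∗ B} (f ,∗ H (pt A)) const∗
  nullHomotopic⇒≡const∗ {A = A} {B} f H =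
    cong (λ φ → (proj₁ ∘′ φ) ,∗ proj₂ (φ (pt A))) (ext λ x → contract (H x))
    where
    contract : ∀ {y} (p : y ≡ pt B) →
               _≡_ {A = Σ[ z ∈ ty B ] z ≡ pt B} (y , p) (pt B , refl)
    contract refl = refl

  constant⇒≡const∗ : {A B : Pointed ℓ} (f : A →∗ B) →
                     (∀ x → _→∗_.fun f x ≡ _→∗_.fun f (pt A)) → f ≡ const∗
  constant⇒≡const∗ {A = A} (f ,∗ f₀) K =
    trans (cong (f ,∗_) (sym H-pt)) (nullHomotopic⇒≡const∗ f H)
    where
    -- The factor `sym (K (pt A))` normalises the null-homotopy so that at the basepoint it is the
    -- given path `f₀`.
    H : ∀ x → f x ≡ _
    H x = trans (K x) (trans (sym (K (pt A))) f₀)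

    H-pt : H (pt A) ≡ f₀
    H-pt = trans (sym (trans-assoc (K (pt A))))
                 (cong (λ p → trans p f₀) (trans-symʳ (K (pt A))))

  CoconeOn-irrelevant : {Γ : Graph ℓ} (F : Diagram (𝒰∗ ℓ) Γ) (X : Pointed ℓ) →
                        (∀ i → Irrelevant (Diagram.obj F i →∗ X)) →
                        Irrelevant (CoconeOn F X)
  CoconeOn-irrelevant F X irr (s , K) (s′ , K′) =
    pairs (ext λ i → irr i (s i) (s′ i)) K K′
    where
    open WildCategory (𝒰∗ _) using (_∘_)
    open Diagram F

    -- With both families of legs free, path induction identifies them; the commutation paths then
    -- lie in path types of propositions.
    pairs : ∀ {t t′} → t ≡ t′ →
            (L  : ∀ i j g → t j ∘ mor g ≡ t i)
            (L′ : ∀ i j g → t′ j ∘ mor g ≡ t′ i) →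
            _≡_ {A = CoconeOn F X} (t , L) (t′ , L′)
    pairs refl L L′ = cong (_ ,_) (ext λ i → ext λ j → ext λ g →
      irrelevant⇒≡-irrelevant (irr i) (L i j g) (L′ i j g))

module _ (PO : PushoutTypes) where
  open PushoutTypes PO

  merid : {A : Set ℓ} → A → _≡_ {A = Susp PO A} (inl tt) (inr tt)
  merid = glue {f = λ _ → tt} {g = λ _ → tt}

  module _ {A : Set ℓ} {Y : Set b} {y z : Y} (q : A → y ≡ z) where

    private
      e : ∀ x → subst (λ _ → Y) (merid x) y ≡ z
      e x = trans (subst-const (merid x)) (q x)

    Susp-rec : Susp PO A → Y
    Susp-rec = elim (λ _ → Y) (λ _ → y) (λ _ → z) e

    Susp-rec-north : Susp-rec (inl tt) ≡ y
    Susp-rec-north = elim-inl (λ _ → Y) (λ _ → y) (λ _ → z) e tt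

    Susp-rec-south : Susp-rec (inr tt) ≡ z
    Susp-rec-south = elim-inr (λ _ → Y) (λ _ → y) (λ _ → z) e tt

    -- Solving the computation rule on meridians for `q x` shows that `q x` depends on `x` only
    -- through `merid x`. The outer paths correct for endpoints that compute only up to a path.
    Susp-rec-merid : ∀ x → q x ≡ trans (sym Susp-rec-north)
                                (trans (cong Susp-rec (merid x)) Susp-rec-south)
    Susp-rec-merid x =
      solve-for-q (merid x) Susp-rec-north Susp-rec-south (q x)
                  (elim-glue (λ _ → Y) (λ _ → y) (λ _ → z) e x)
      where
      solve-for-q : ∀ {s t} (p : s ≡ t) {y z : Y}
        (n : Susp-rec s ≡ y) (m : Susp-rec t ≡ z) (r : y ≡ z) →
        dcong Susp-rec p ≡ trans (cong (subst (λ _ → Y) p) n)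
                                 (trans (trans (subst-const p) r) (sym m)) →
        r ≡ trans (sym n) (trans (cong Susp-rec p) m)
      solve-for-q refl refl refl r eq =
        trans (sym (trans-reflʳ r)) (sym eq)

  Susp∗ : Pointed ℓ → Pointed ℓ
  Susp∗ A = record { ty = Susp PO (ty A) ; pt = inl tt }

  →∗ΩSusp∗-irrelevant⇒Acyclic : (A : Pointed ℓ) →
                                Irrelevant (A →∗ Ω (Susp∗ A)) →
                                Acyclic PO (ty A)
  →∗ΩSusp∗-irrelevant⇒Acyclic A irr =
    -- The south pole is joined to the north by the meridian of the basepoint, so coherence over
    -- `merid x` amounts to `merid x ≡ merid (pt A)`.
    inl tt , elim (inl tt ≡_) (λ _ → refl) (λ _ → merid (pt A)) path
    where
    unit : A →∗ Ω (Susp∗ A)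
    unit = (λ x → trans (merid x) (sym (merid (pt A))))
           ,∗ trans-symʳ (merid (pt A))

    cancel : ∀ {x y z : Susp PO (ty A)} (p : x ≡ y) (q : z ≡ y) →
             trans (trans p (sym q)) q ≡ p
    cancel p refl = trans (trans-reflʳ _) (trans-reflʳ p)

    subst-refl : ∀ {x y : Susp PO (ty A)} (p : x ≡ y) →
                 subst (x ≡_) p refl ≡ p
    subst-refl refl = refl

    path : ∀ x → subst (inl tt ≡_) (merid x) refl ≡ merid (pt A)
    path x =
      trans (subst-refl (merid x))
      (trans (sym (cancel (merid x) (merid (pt A))))
             -- Equating `unit` with `const∗` replaces the loop at `x` by `refl`, leaving
             -- `merid (pt A)`.
             (cong (λ f → trans (_→∗_.fun f x) (merid (pt A)))
                   (irr unit const∗)))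

  module _ (ext : ∀ {a b} → Extensionality a b) where

    -- In a contractible suspension all meridians agree. A map to `Ω Y` is a family of paths from
    -- `pt Y` to itself, so it factors through `merid` and is constant.
    Acyclic⇒→∗Ω-irrelevant : (A Y : Pointed ℓ) → Acyclic PO (ty A) →
                             Irrelevant (A →∗ Ω Y)
    Acyclic⇒→∗Ω-irrelevant A Y acyclic f g =
      trans (constant⇒≡const∗ ext f (constant f))
            (sym (constant⇒≡const∗ ext g (constant g)))
      where
      merid-constant : ∀ x → merid x ≡ merid (pt A)
      merid-constant x =
        irrelevant⇒≡-irrelevant (isContr⇒irrelevant acyclic) _ _

      constant : (f : A →∗ Ω Y) → ∀ x → _→∗_.fun f x ≡ _→∗_.fun f (pt A)
      constant (f ,∗ _) x =
        trans (Susp-rec-merid f x)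
        (trans (cong (λ p → trans (sym (Susp-rec-north f))
                            (trans (cong (Susp-rec f) p) (Susp-rec-south f)))
                     (merid-constant x))
               (sym (Susp-rec-merid f (pt A))))

corollary6p6 : (∀ {a b} → Extensionality a b) →
    (PO : PushoutTypes) →
    {ℓ : Level} (Γ : Graph ℓ) (F : Diagram (𝒰∗ ℓ) Γ) →
    ((i : Graph.Γ₀ Γ) → Acyclic PO (ty (Diagram.obj F i))) →
    (κ : Cocone F) → IsColimiting F κ →
    Acyclic PO (ty (Cocone.apex κ))
corollary6p6 ext PO Γ F acyclic κ colimiting =
  →∗ΩSusp∗-irrelevant⇒Acyclic PO C λ f g →
    isEquiv⇒injective (colimiting X)
      (CoconeOn-irrelevant ext F X
        (λ i → Acyclic⇒→∗Ω-irrelevant PO ext (Diagram.obj F i) (Susp∗ PO C)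
                                      (acyclic i))
        (postcomp F κ X f) (postcomp F κ X g))
  where
  C = Cocone.apex κ
  -- Suspension and loops stay in the universe of `C`, so this is an admissible test object for the
  -- colimit.
  X = Ω (Susp∗ PO C)
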